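{- Let $\alpha,\beta$ be real (or complex) parameters, let $n,p$ be non-negative integers ($p\ge1$), and let $k_1,\ldots,k_p$ be non-negative integers with $k=k_1+\cdots+k_p$. Then $$\binom{k}{k_1,\ldots,k_p}\genfrac{\lfloor}{\rfloor}{0pt}{}{n}{k}^{\alpha,\beta}=\sum_{\substack{l_1+\cdots+l_p=n\\ l_i\ge0}}\binom{n}{l_1,\ldots,l_p}\genfrac{\lfloor}{\rfloor}{0pt}{}{l_1}{k_1}^{\alpha,\beta}\cdots\genfrac{\lfloor}{\rfloor}{0pt}{}{l_p}{k_p}^{\alpha,\beta}.$$
   Context: For parameters $\alpha,\beta$, the generalized Stirling numbers $\genfrac{\lfloor}{\rfloor}{0pt}{}{n}{k}^{\alpha,\beta}$, $0\le k\le n$, are defined by the polynomial identity in $x$ $$x(x+\alpha)\cdots(x+(n-1)\alpha)=\sum_{k=0}^{n}\genfrac{\lfloor}{\rfloor}{0pt}{}{n}{k}^{\alpha,\beta}\,x(x-\beta)\cdots(x-(k-1)\beta),$$ (empty products equal $1$), and $\genfrac{\lfloor}{\rfloor}{0pt}{}{n}{k}^{\alpha,\beta}=0$ for $k<0$ or $k>n$. $\binom{m}{m_1,\ldots,m_p}=\frac{m!}{m_1!\cdots m_p!}$ denotes the multinomial coefficient. -}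

module Defs where

open import Algebra.Bundles using (CommutativeRing)
import Algebra.Definitions.RawMonoid as RawMonoidDefs
open import Data.List.Base as List using (List; []; _∷_; [_]; concatMap; upTo)
open import Data.Nat.Base as ℕ using (ℕ; zero; suc; _∸_; _!; NonZero)
open import Data.Nat.DivMod using (_/_)
open import Data.Nat.Properties using (m*n≢0; _!≢0)
open import Data.Product.Base using (_×_)
open import Data.Vec.Base as Vec using (Vec; []; _∷_)
open import Level using (_⊔_)

-- All vectors of p natural numbers with sum n, each listed exactly once.
weakCompositions : (p n : ℕ) → List (Vec ℕ p)
weakCompositions zero    zero    = [ [] ]
weakCompositions zero    (suc n) = []
weakCompositions (suc p) n       =
  concatMap (λ l → List.map (l ∷_) (weakCompositions p (n ∸ l))) (upTo (suc n))

factorials : ∀ {p} → Vec ℕ p → ℕ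
factorials []       = 1
factorials (m ∷ ms) = m ! ℕ.* factorials ms

factorials≢0 : ∀ {p} (ms : Vec ℕ p) → NonZero (factorials ms)
factorials≢0 []       = _
factorials≢0 (m ∷ ms) = m*n≢0 (m !) (factorials ms) {{m !≢0}} {{factorials≢0 ms}}

-- The division is exact when m is the sum of ms, the only case of interest.
multinomial : ∀ {p} → ℕ → Vec ℕ p → ℕ
multinomial m ms = _/_ (m !) (factorials ms) {{factorials≢0 ms}}

module GeneralizedStirling {c ℓ} (R : CommutativeRing c ℓ) where
  open CommutativeRing R
  open RawMonoidDefs +-rawMonoid public using () renaming (_×_ to _×ᵣ_)

  ∑ : List Carrier → Carrier
  ∑ = List.foldr _+_ 0#

  ∏ : ∀ {p} → Vec Carrier p → Carrier
  ∏ = Vec.foldr′ _*_ 1#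

  -- Formal polynomials in one variable: coefficients, constant term first.
  -- Trailing zeros are allowed, so equality is that of all coefficients.
  Poly : Set c
  Poly = List Carrier

  coeff : Poly → ℕ → Carrier
  coeff []      _       = 0#
  coeff (a ∷ f) zero    = a
  coeff (a ∷ f) (suc i) = coeff f i

  infix  4 _≈ₚ_
  infixl 6 _+ₚ_
  infixl 7 _*ₚ_ _·ₚ_

  _≈ₚ_ : Poly → Poly → Set ℓ
  f ≈ₚ g = ∀ i → coeff f i ≈ coeff g i

  _+ₚ_ : Poly → Poly → Poly
  []      +ₚ g       = g
  (a ∷ f) +ₚ []      = a ∷ f
  (a ∷ f) +ₚ (b ∷ g) = (a + b) ∷ (f +ₚ g)

  _·ₚ_ : Carrier → Poly → Poly
  a ·ₚ f = List.map (a *_) f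

  _*ₚ_ : Poly → Poly → Poly
  []      *ₚ g = []
  (a ∷ f) *ₚ g = (a ·ₚ g) +ₚ (0# ∷ (f *ₚ g))

  ∑ₚ : List Poly → Poly
  ∑ₚ = List.foldr _+ₚ_ []

  ∏ₚ : List Poly → Poly
  ∏ₚ = List.foldr _*ₚ_ [ 1# ]

  X+_ : Carrier → Poly
  X+ a = a ∷ 1# ∷ []

  -- x (x + α) ⋯ (x + (n - 1) α)
  rising : Carrier → ℕ → Poly
  rising α n = ∏ₚ (List.map (λ i → X+ (i ×ᵣ α)) (upTo n))

  -- x (x - β) ⋯ (x - (k - 1) β)
  falling : Carrier → ℕ → Poly
  falling β k = ∏ₚ (List.map (λ i → X+ (- (i ×ᵣ β))) (upTo k))

  -- S n k is the generalized Stirling number ⌊n, k⌋ with parameters α, β.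
  -- As falling β k is monic of degree k, exactly one S (up to ≈) qualifies.
  IsGeneralizedStirling : (α β : Carrier) → (ℕ → ℕ → Carrier) → Set ℓ
  IsGeneralizedStirling α β S =
    (∀ n → rising α n ≈ₚ ∑ₚ (List.map (λ k → S n k ·ₚ falling β k) (upTo (suc n))))
    × (∀ n k → n ℕ.< k → S n k ≈ 0#)

{-# OPTIONS --safe #-}

-- Expanding in the basis of the falling products, which is unitriangular over
-- the monomials, gives the recurrence
-- S (n + 1) k = S n (k - 1) + (n α + k β) S n k.
-- For p = 2 both sides of the claim satisfy the same recurrence in n: for the
-- right-hand side, binomial convolution obeys the Leibniz rule under the shift
-- n ↦ n + 1, and the coefficients add up as
-- (l α + a β) + ((n - l) α + b β) = n α + (a + b) β.
-- The general case follows by splitting off one part at a time.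
module Submission where

open import Defs
open import Algebra.Bundles using (CommutativeRing)
import Algebra.Properties.AbelianGroup as AbelianGroupProperties
import Algebra.Properties.Semiring.Mult as Mult
import Algebra.Solver.Ring.NaturalCoefficients.Default as RingSolver
open import Data.List.Base using (List; []; _∷_; _++_; map; concatMap; upTo; applyUpTo)
open import Data.List.Properties using (map-∘; map-++; map-upTo)
open import Data.List.Relation.Unary.All using (All; []; _∷_)
import Data.List.Relation.Unary.All as All
import Data.List.Relation.Unary.All.Properties as All
open import Data.Nat.Base as ℕ using (ℕ; zero; suc; _≤_; _<_; _∸_; _!; s≤s; s<s; z<s)
open import Data.Nat.Combinatorics using (_C_; nCk≡n!/k![n-k]!;
  nCk+nC[k+1]≡[n+1]C[k+1]; k>n⇒nCk≡0; nCn≡1; [n∸k]!k!∣n!)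
open import Data.Nat.Divisibility using (_∣_)
open import Data.Nat.DivMod using (m*n/n≡m; m/n*n≡m; /-congˡ)
import Data.Nat.Properties as ℕ
open import Data.Product.Base using (proj₁; proj₂)
open import Data.Sum.Base using (_⊎_; inj₁; inj₂)
open import Data.Vec.Base using (Vec; []; _∷_; sum; zipWith)
open import Function.Base using (_∘_)
open import Relation.Nullary.Decidable.Core using (yes; no)
open import Relation.Binary.PropositionalEquality as ≡ using (_≡_; cong; subst)
import Relation.Binary.Reasoning.Setoid as SetoidReasoning

-- Multinomial coefficients as products of binomial coefficients.

binomial-factorials : ∀ m k → ((m ℕ.+ k) C m) ℕ.* (m ! ℕ.* k !) ≡ (m ℕ.+ k) !
binomial-factorials m k = begin
  ((m ℕ.+ k) C m) ℕ.* (m ! ℕ.* k !)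
    ≡⟨ cong (λ j → ((m ℕ.+ k) C m) ℕ.* (m ! ℕ.* j !)) (ℕ.m+n∸m≡n m k) ⟨
  ((m ℕ.+ k) C m) ℕ.* (m ! ℕ.* (m ℕ.+ k ∸ m) !)
    ≡⟨ cong (ℕ._* (m ! ℕ.* (m ℕ.+ k ∸ m) !)) (nCk≡n!/k![n-k]! (ℕ.m≤m+n m k)) ⟩
  _
    ≡⟨ m/n*n≡m (subst (_∣ (m ℕ.+ k) !) (ℕ.*-comm ((m ℕ.+ k ∸ m) !) (m !)) ([n∸k]!k!∣n! (ℕ.m≤m+n m k))) ⟩
  (m ℕ.+ k) ! ∎
  where
  open ≡.≡-Reasoning
  instance _ = ℕ._!*_!≢0 m (m ℕ.+ k ∸ m)

-- The division defining `multinomial` is exact. The proof is mutual with `multinomial-∷`: exactness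
-- for the tail exhibits `(m + sum ms) !` as a multiple of `factorials (m ∷ ms)`, which yields the
-- factorisation and then exactness for `m ∷ ms`.
multinomial-factorials : ∀ {p} (ms : Vec ℕ p) →
  multinomial (sum ms) ms ℕ.* factorials ms ≡ sum ms !

multinomial-∷ : ∀ {p} m (ms : Vec ℕ p) →
  multinomial (sum (m ∷ ms)) (m ∷ ms) ≡ ((m ℕ.+ sum ms) C m) ℕ.* multinomial (sum ms) ms

binomial-multinomial-factorials : ∀ {p} m (ms : Vec ℕ p) →
  ((m ℕ.+ sum ms) C m) ℕ.* multinomial (sum ms) ms ℕ.* factorials (m ∷ ms) ≡ (m ℕ.+ sum ms) !
binomial-multinomial-factorials m ms = begin
  b ℕ.* q ℕ.* (m ! ℕ.* f)  ≡⟨ ℕ.*-assoc b q (m ! ℕ.* f) ⟩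
  b ℕ.* (q ℕ.* (m ! ℕ.* f))  ≡⟨ cong (b ℕ.*_) (ℕ.*-assoc q (m !) f) ⟨
  b ℕ.* (q ℕ.* m ! ℕ.* f)  ≡⟨ cong (λ j → b ℕ.* (j ℕ.* f)) (ℕ.*-comm q (m !)) ⟩
  b ℕ.* (m ! ℕ.* q ℕ.* f)  ≡⟨ cong (b ℕ.*_) (ℕ.*-assoc (m !) q f) ⟩
  b ℕ.* (m ! ℕ.* (q ℕ.* f))  ≡⟨ cong (λ j → b ℕ.* (m ! ℕ.* j)) (multinomial-factorials ms) ⟩
  b ℕ.* (m ! ℕ.* sum ms !)  ≡⟨ binomial-factorials m (sum ms) ⟩
  (m ℕ.+ sum ms) !         ∎
  where
  open ≡.≡-Reasoning
  b = (m ℕ.+ sum ms) C m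
  q = multinomial (sum ms) ms
  f = factorials ms

multinomial-∷ m ms = ≡.trans
  (/-congˡ {{factorials≢0 (m ∷ ms)}} (≡.sym (binomial-multinomial-factorials m ms)))
  (m*n/n≡m _ (factorials (m ∷ ms)) {{factorials≢0 (m ∷ ms)}})

multinomial-factorials []       = ≡.refl
multinomial-factorials (m ∷ ms) = ≡.trans
  (cong (ℕ._* factorials (m ∷ ms)) (multinomial-∷ m ms))
  (binomial-multinomial-factorials m ms)

-- `multinomial-∷` speaks of a vector together with its own sum; this lets it be applied to the
-- vectors enumerated for a given `n`.
weakCompositions-sum : ∀ p n → All (λ ls → sum ls ≡ n) (weakCompositions p n)
weakCompositions-sum zero    zero    = ≡.refl ∷ []
weakCompositions-sum zero    (suc n) = []
weakCompositions-sum (suc p) n       = All.concat⁺ (All.map⁺ (All.map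
  (λ {l} l<1+n → All.map⁺ (All.map
    (λ eq → ≡.trans (cong (l ℕ.+_) eq) (ℕ.m+[n∸m]≡n (ℕ.≤-pred l<1+n)))
    (weakCompositions-sum p (n ∸ l))))
  (All.all-upTo (suc n))))

module _ {c ℓ} (R : CommutativeRing c ℓ) where
  open CommutativeRing R
  open GeneralizedStirling R
  open AbelianGroupProperties +-abelianGroup using () renaming (∙-cancelʳ to +-cancelʳ)
  open Mult semiring using (×-congʳ; ×-congˡ; ×-homo-+; ×-assoc-*; ×1-homo-*)
  open RingSolver commutativeSemiring using (solve; con; _:=_; _:+_; _:*_)
  open SetoidReasoning setoid

  -- Natural multiples and finite sums in the ring.

  -- Writing `n ×ᵣ x` as `ι n * x` turns multiples into products, which the semiring solver can
  -- rearrange.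
  ι : ℕ → Carrier
  ι n = n ×ᵣ 1#

  ι-+ : ∀ m n → ι (m ℕ.+ n) ≈ ι m + ι n
  ι-+ = ×-homo-+ 1#

  ×≈ι* : ∀ n x → n ×ᵣ x ≈ ι n * x
  ×≈ι* n x = sym (trans (×-assoc-* n 1# x) (×-congʳ n (*-identityˡ x)))

  ∑-cong : ∀ {a} {A : Set a} {f g : A → Carrier} {xs} →
    All (λ x → f x ≈ g x) xs → ∑ (map f xs) ≈ ∑ (map g xs)
  ∑-cong []         = refl
  ∑-cong (eq ∷ eqs) = +-cong eq (∑-cong eqs)

  ∑-++ : ∀ xs ys → ∑ (xs ++ ys) ≈ ∑ xs + ∑ ys
  ∑-++ []       ys = sym (+-identityˡ _)
  ∑-++ (x ∷ xs) ys = trans (+-congˡ (∑-++ xs ys)) (sym (+-assoc _ _ _))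

  ∑-concatMap : ∀ {a b} {A : Set a} {B : Set b} (f : B → Carrier) (g : A → List B) xs →
    ∑ (map f (concatMap g xs)) ≈ ∑ (map (λ x → ∑ (map f (g x))) xs)
  ∑-concatMap f g []       = refl
  ∑-concatMap f g (x ∷ xs) = begin
    ∑ (map f (g x ++ concatMap g xs))          ≡⟨ cong ∑ (map-++ f (g x) _) ⟩
    ∑ (map f (g x) ++ map f (concatMap g xs))  ≈⟨ ∑-++ (map f (g x)) _ ⟩
    ∑ (map f (g x)) + ∑ (map f (concatMap g xs)) ≈⟨ +-congˡ (∑-concatMap f g xs) ⟩
    _ ∎

  ∑-*ˡ : ∀ {a} {A : Set a} x (f : A → Carrier) ys →
    ∑ (map (λ y → x * f y) ys) ≈ x * ∑ (map f ys)
  ∑-*ˡ x f []       = sym (zeroʳ x)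
  ∑-*ˡ x f (y ∷ ys) = trans (+-congˡ (∑-*ˡ x f ys)) (sym (distribˡ x _ _))

  -- With `applyUpTo`, a sum of `suc n` terms unfolds definitionally into `f 0` plus the sum of
  -- `f ∘ suc`; `map-upTo` links it to the sums over `upTo`.
  ∑< : ℕ → (ℕ → Carrier) → Carrier
  ∑< n f = ∑ (applyUpTo f n)

  ∑<-cong : ∀ n {f g} → (∀ {i} → i < n → f i ≈ g i) → ∑< n f ≈ ∑< n g
  ∑<-cong zero    eq = refl
  ∑<-cong (suc n) eq = +-cong (eq z<s) (∑<-cong n (eq ∘ s<s))

  ∑<-zero : ∀ n {f} → (∀ {i} → i < n → f i ≈ 0#) → ∑< n f ≈ 0#
  ∑<-zero zero    eq = refl
  ∑<-zero (suc n) eq = trans (+-cong (eq z<s) (∑<-zero n (eq ∘ s<s))) (+-identityˡ 0#)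

  ∑<-+ : ∀ n f g → ∑< n (λ i → f i + g i) ≈ ∑< n f + ∑< n g
  ∑<-+ zero    f g = sym (+-identityˡ 0#)
  ∑<-+ (suc n) f g = begin
    f 0 + g 0 + ∑< n (λ i → f (suc i) + g (suc i))
      ≈⟨ +-congˡ (∑<-+ n (f ∘ suc) (g ∘ suc)) ⟩
    f 0 + g 0 + (∑< n (f ∘ suc) + ∑< n (g ∘ suc))
      ≈⟨ solve 4 (λ a b c d → a :+ b :+ (c :+ d) := a :+ c :+ (b :+ d)) refl _ _ _ _ ⟩
    _ ∎

  ∑<-*ˡ : ∀ n x f → ∑< n (λ i → x * f i) ≈ x * ∑< n f
  ∑<-*ˡ zero    x f = sym (zeroʳ x)
  ∑<-*ˡ (suc n) x f = trans (+-congˡ (∑<-*ˡ n x (f ∘ suc))) (sym (distribˡ x _ _))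

  ∑<-last : ∀ n f → ∑< (suc n) f ≈ ∑< n f + f n
  ∑<-last zero    f = +-comm _ _
  ∑<-last (suc n) f = trans (+-congˡ (∑<-last n (f ∘ suc))) (sym (+-assoc _ _ _))

  -- Coefficients of products of linear factors.

  -- Multiplication by the variable on coefficient sequences. Applied to `S n` it also encodes
  -- `S n (k - 1)`, with value 0 at `k = 0`.
  shift : (ℕ → Carrier) → ℕ → Carrier
  shift f zero    = 0#
  shift f (suc i) = f i

  shift-cong : ∀ {f g} → (∀ i → f i ≈ g i) → ∀ i → shift f i ≈ shift g i
  shift-cong eq zero    = refl
  shift-cong eq (suc i) = eq i

  -- Multiplication by X+ a on coefficient sequences.
  lin : Carrier → (ℕ → Carrier) → ℕ → Carrier
  lin a f i = a * f i + shift f i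

  lin-cong : ∀ {a} {f g : ℕ → Carrier} → (∀ i → f i ≈ g i) → ∀ i → lin a f i ≈ lin a g i
  lin-cong eq i = +-cong (*-congˡ (eq i)) (shift-cong eq i)

  lin-comm : ∀ a b f i → lin a (lin b f) i ≈ lin b (lin a f) i
  lin-comm a b f zero    =
    solve 3 (λ a b x → a :* (b :* x :+ con 0) :+ con 0 := b :* (a :* x :+ con 0) :+ con 0)
      refl a b (f 0)
  lin-comm a b f (suc i) =
    solve 5 (λ a b x y z → a :* (b :* x :+ y) :+ (b :* y :+ z) := b :* (a :* x :+ y) :+ (a :* y :+ z))
      refl a b (f (suc i)) (f i) (shift f i)

  coeff-+ₚ : ∀ f g i → coeff (f +ₚ g) i ≈ coeff f i + coeff g i
  coeff-+ₚ []      g       i       = sym (+-identityˡ _)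
  coeff-+ₚ (a ∷ f) []      i       = sym (+-identityʳ _)
  coeff-+ₚ (a ∷ f) (b ∷ g) zero    = refl
  coeff-+ₚ (a ∷ f) (b ∷ g) (suc i) = coeff-+ₚ f g i

  coeff-·ₚ : ∀ a f i → coeff (a ·ₚ f) i ≈ a * coeff f i
  coeff-·ₚ a []      i       = sym (zeroʳ a)
  coeff-·ₚ a (b ∷ f) zero    = refl
  coeff-·ₚ a (b ∷ f) (suc i) = coeff-·ₚ a f i

  coeff-∑ₚ : ∀ n (g : ℕ → Poly) i →
    coeff (∑ₚ (applyUpTo g n)) i ≈ ∑< n (λ k → coeff (g k) i)
  coeff-∑ₚ zero    g i = refl
  coeff-∑ₚ (suc n) g i = trans (coeff-+ₚ (g 0) _ i) (+-congˡ (coeff-∑ₚ n (g ∘ suc) i))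

  coeff-X+-*ₚ : ∀ a f i → coeff ((X+ a) *ₚ f) i ≈ lin a (coeff f) i
  coeff-X+-*ₚ a f i = trans (coeff-+ₚ (a ·ₚ f) _ i) (+-cong (coeff-·ₚ a f i) (rest i))
    where
    -- Unfolding the product with `1# ∷ []` leaves the summand `0# ∷ []`, whose tail is `[] *ₚ f`.
    coeff-[0] : ∀ i → coeff (0# ∷ []) i ≈ 0#
    coeff-[0] zero    = refl
    coeff-[0] (suc i) = refl

    rest : ∀ i → coeff (0# ∷ ((1# ∷ []) *ₚ f)) i ≈ shift (coeff f) i
    rest zero    = refl
    rest (suc i) = begin
      coeff ((1# ·ₚ f) +ₚ (0# ∷ [])) i        ≈⟨ coeff-+ₚ (1# ·ₚ f) _ i ⟩
      coeff (1# ·ₚ f) i + coeff (0# ∷ []) i   ≈⟨ +-cong (coeff-·ₚ 1# f i) (coeff-[0] i) ⟩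
      1# * coeff f i + 0#                     ≈⟨ +-identityʳ _ ⟩
      1# * coeff f i                          ≈⟨ *-identityˡ _ ⟩
      coeff f i                               ∎

  -- Common form of `rising α` and `falling β`, which are definitionally its instances at `i ×ᵣ α`
  -- and `- (i ×ᵣ β)`.
  linearProduct : (ℕ → Carrier) → ℕ → Poly
  linearProduct a n = ∏ₚ (map (λ i → X+ (a i)) (upTo n))

  -- `∏ₚ` has the factor of index 0 outermost, whereas induction on `n` needs the last factor there;
  -- `lin-comm` moves it outwards past one factor at a time.
  coeff-linearProduct : ∀ a n i →
    coeff (linearProduct a (suc n)) i ≈ lin (a n) (coeff (linearProduct a n)) i
  coeff-linearProduct a n i = begin
    coeff (linearProduct a (suc n)) i        ≡⟨ cong (λ f → coeff f i) (linearProduct≡product (suc n)) ⟩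
    coeff (product a (suc n)) i              ≈⟨ go a n i ⟩
    lin (a n) (coeff (product a n)) i        ≡⟨ cong (λ f → lin (a n) (coeff f) i) (linearProduct≡product n) ⟨
    lin (a n) (coeff (linearProduct a n)) i  ∎
    where
    product : (ℕ → Carrier) → ℕ → Poly
    product a n = ∏ₚ (applyUpTo (λ i → X+ (a i)) n)

    linearProduct≡product : ∀ n → linearProduct a n ≡ product a n
    linearProduct≡product n = cong ∏ₚ (map-upTo (λ i → X+ (a i)) n)

    -- The sequence is generalised because removing the outermost factor replaces `a` by `a ∘ suc`.
    go : ∀ a n i → coeff (product a (suc n)) i ≈ lin (a n) (coeff (product a n)) i
    go a zero    i = coeff-X+-*ₚ (a 0) (1# ∷ []) i
    go a (suc n) i = begin
      coeff (product a (suc (suc n))) i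
        ≈⟨ coeff-X+-*ₚ (a 0) (product (a ∘ suc) (suc n)) i ⟩
      lin (a 0) (coeff (product (a ∘ suc) (suc n))) i
        ≈⟨ lin-cong (go (a ∘ suc) n) i ⟩
      lin (a 0) (lin (a (suc n)) (coeff (product (a ∘ suc) n))) i
        ≈⟨ lin-comm (a 0) (a (suc n)) _ i ⟩
      lin (a (suc n)) (lin (a 0) (coeff (product (a ∘ suc) n))) i
        ≈⟨ lin-cong (λ j → coeff-X+-*ₚ (a 0) (product (a ∘ suc) n) j) i ⟨
      lin (a (suc n)) (coeff (product a (suc n))) i ∎

  linearProduct-degree : ∀ a n {i} → n < i → coeff (linearProduct a n) i ≈ 0#
  linearProduct-degree a zero    (s≤s _)         = refl
  linearProduct-degree a (suc n) {suc i} (s≤s n<i) = begin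
    coeff (linearProduct a (suc n)) (suc i)
      ≈⟨ coeff-linearProduct a n (suc i) ⟩
    a n * coeff (linearProduct a n) (suc i) + coeff (linearProduct a n) i
      ≈⟨ +-cong (*-congˡ (linearProduct-degree a n (ℕ.m<n⇒m<1+n n<i))) (linearProduct-degree a n n<i) ⟩
    a n * 0# + 0#
      ≈⟨ trans (+-identityʳ _) (zeroʳ _) ⟩
    0# ∎

  linearProduct-monic : ∀ a n → coeff (linearProduct a n) n ≈ 1#
  linearProduct-monic a zero    = refl
  linearProduct-monic a (suc n) = begin
    coeff (linearProduct a (suc n)) (suc n)
      ≈⟨ coeff-linearProduct a n (suc n) ⟩
    a n * coeff (linearProduct a n) (suc n) + coeff (linearProduct a n) n
      ≈⟨ +-cong (*-congˡ (linearProduct-degree a n ℕ.≤-refl)) (linearProduct-monic a n) ⟩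
    a n * 0# + 1#
      ≈⟨ trans (+-congʳ (zeroʳ _)) (+-identityˡ _) ⟩
    1# ∎

  -- Uniqueness of expansions in a unitriangular basis, and linearity of `lin`.

  -- `F k i` is the coefficient of degree `i` in the basis element `k`. In degree `n` only the last
  -- of the `suc n` basis elements contributes, with coefficient 1, so the last coordinates agree;
  -- cancelling that term leaves a shorter expansion.
  expansion-unique : (F : ℕ → ℕ → Carrier) →
    (∀ k → F k k ≈ 1#) → (∀ k {i} → k < i → F k i ≈ 0#) →
    ∀ n (a b : ℕ → Carrier) →
    (∀ i → ∑< n (λ k → a k * F k i) ≈ ∑< n (λ k → b k * F k i)) →
    ∀ {k} → k < n → a k ≈ b k
  expansion-unique F monic degree (suc n) a b eq k<1+n = conclude (ℕ.m≤n⇒m<n∨m≡n (ℕ.≤-pred k<1+n))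
    where
    top : ∀ a → ∑< (suc n) (λ k → a k * F k n) ≈ a n
    top a = begin
      ∑< (suc n) (λ k → a k * F k n)
        ≈⟨ ∑<-last n (λ k → a k * F k n) ⟩
      ∑< n (λ k → a k * F k n) + a n * F n n
        ≈⟨ +-cong (∑<-zero n (λ {k} k<n → trans (*-congˡ (degree k k<n)) (zeroʳ _))) (*-congˡ (monic n)) ⟩
      0# + a n * 1#
        ≈⟨ trans (+-identityˡ _) (*-identityʳ _) ⟩
      a n ∎

    aₙ≈bₙ : a n ≈ b n
    aₙ≈bₙ = trans (sym (top a)) (trans (eq n) (top b))

    eq′ : ∀ i → ∑< n (λ k → a k * F k i) ≈ ∑< n (λ k → b k * F k i)
    eq′ i = +-cancelʳ (a n * F n i) _ _ (begin
      ∑< n (λ k → a k * F k i) + a n * F n i  ≈⟨ ∑<-last n (λ k → a k * F k i) ⟨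
      ∑< (suc n) (λ k → a k * F k i)          ≈⟨ eq i ⟩
      ∑< (suc n) (λ k → b k * F k i)          ≈⟨ ∑<-last n (λ k → b k * F k i) ⟩
      ∑< n (λ k → b k * F k i) + b n * F n i  ≈⟨ +-congˡ (*-congʳ aₙ≈bₙ) ⟨
      ∑< n (λ k → b k * F k i) + a n * F n i  ∎)

    conclude : ∀ {k} → k < n ⊎ k ≡ n → a k ≈ b k
    conclude (inj₁ k<n)    = expansion-unique F monic degree n a b eq′ k<n
    conclude (inj₂ ≡.refl) = aₙ≈bₙ

  lin-+ : ∀ a f g i → lin a (λ j → f j + g j) i ≈ lin a f i + lin a g i
  lin-+ a f g zero    =
    solve 3 (λ a x y → a :* (x :+ y) :+ con 0 := a :* x :+ con 0 :+ (a :* y :+ con 0))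
      refl a (f 0) (g 0)
  lin-+ a f g (suc i) =
    solve 5 (λ a x y z w → a :* (x :+ y) :+ (z :+ w) := a :* x :+ z :+ (a :* y :+ w))
      refl a (f (suc i)) (g (suc i)) (f i) (g i)

  lin-* : ∀ a x f i → lin a (λ j → x * f j) i ≈ x * lin a f i
  lin-* a x f zero    =
    solve 3 (λ a x y → a :* (x :* y) :+ con 0 := x :* (a :* y :+ con 0)) refl a x (f 0)
  lin-* a x f (suc i) =
    solve 4 (λ a x y z → a :* (x :* y) :+ x :* z := x :* (a :* y :+ z)) refl a x (f (suc i)) (f i)

  lin-∑< : ∀ a n (s : ℕ → Carrier) (F : ℕ → ℕ → Carrier) i →
    lin a (λ j → ∑< n (λ k → s k * F k j)) i ≈ ∑< n (λ k → s k * lin a (F k) i)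
  lin-∑< a zero    s F zero    = trans (+-identityʳ _) (zeroʳ a)
  lin-∑< a zero    s F (suc i) = trans (+-identityʳ _) (zeroʳ a)
  lin-∑< a (suc n) s F i       = trans
    (lin-+ a (λ j → s 0 * F 0 j) (λ j → ∑< n (λ k → s (suc k) * F (suc k) j)) i)
    (+-cong (lin-* a (s 0) (F 0) i) (lin-∑< a n (s ∘ suc) (F ∘ suc) i))

  -- Binomial convolution.

  -- The binomial convolution of f and g when h i j = f i * g j.
  convolve : ℕ → (ℕ → ℕ → Carrier) → Carrier
  convolve n h = ∑< (suc n) (λ l → ι (n C l) * h l (n ∸ l))

  -- Restricting the hypothesis to `i + j ≡ n` is what allows weights at `i` and `j` to be combined
  -- into one at `n`.
  convolve-cong : ∀ n h h′ → (∀ i j → i ℕ.+ j ≡ n → h i j ≈ h′ i j) → convolve n h ≈ convolve n h′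
  convolve-cong n h h′ eq = ∑<-cong (suc n) {convolution h} {convolution h′}
    (λ {l} l<1+n → *-congˡ (eq l (n ∸ l) (ℕ.m+[n∸m]≡n (ℕ.≤-pred l<1+n))))
    where
    convolution : (ℕ → ℕ → Carrier) → ℕ → Carrier
    convolution h l = ι (n C l) * h l (n ∸ l)

  convolve-zero : ∀ n h → (∀ i j → h i j ≈ 0#) → convolve n h ≈ 0#
  convolve-zero n h eq = ∑<-zero (suc n) {λ l → ι (n C l) * h l (n ∸ l)}
    (λ {l} _ → trans (*-congˡ (eq l (n ∸ l))) (zeroʳ _))

  convolve-+ : ∀ n h h′ → convolve n (λ i j → h i j + h′ i j) ≈ convolve n h + convolve n h′
  convolve-+ n h h′ = trans
    (∑<-cong (suc n) {λ l → ι (n C l) * (h l (n ∸ l) + h′ l (n ∸ l))} (λ _ → distribˡ _ _ _))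
    (∑<-+ (suc n) (λ l → ι (n C l) * h l (n ∸ l)) (λ l → ι (n C l) * h′ l (n ∸ l)))

  convolve-*ˡ : ∀ n x h → convolve n (λ i j → x * h i j) ≈ x * convolve n h
  convolve-*ˡ n x h = trans
    (∑<-cong (suc n) {λ l → ι (n C l) * (x * h l (n ∸ l))} {λ l → x * (ι (n C l) * h l (n ∸ l))}
      (λ _ → solve 3 (λ c x y → c :* (x :* y) := x :* (c :* y)) refl _ x _))
    (∑<-*ˡ (suc n) x (λ l → ι (n C l) * h l (n ∸ l)))

  -- The Leibniz rule. Pascal's rule splits each term after the first: the halves with `n C l` form
  -- the first convolution, those with `n C suc l` join `h₀` to form the second.
  convolve-suc : ∀ n h →
    convolve (suc n) h ≈ convolve n (λ i j → h (suc i) j) + convolve n (λ i j → h i (suc j))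
  convolve-suc n h = begin
    h₀ + ∑< (suc n) (λ l → ι (suc n C suc l) * h (suc l) (n ∸ l))
      ≈⟨ +-congˡ (∑<-cong (suc n) (λ {l} _ → pascal l)) ⟩
    h₀ + ∑< (suc n) (λ l → ι (n C l) * h (suc l) (n ∸ l) + ι (n C suc l) * h (suc l) (n ∸ l))
      ≈⟨ +-congˡ (∑<-+ (suc n) (λ l → ι (n C l) * h (suc l) (n ∸ l))
           (λ l → ι (n C suc l) * h (suc l) (n ∸ l))) ⟩
    h₀ + (convolve n (λ i j → h (suc i) j) + ∑< (suc n) (λ l → ι (n C suc l) * h (suc l) (n ∸ l)))
      ≈⟨ solve 3 (λ a b c → a :+ (b :+ c) := b :+ (a :+ c)) refl _ _ _ ⟩
    convolve n (λ i j → h (suc i) j) + (h₀ + ∑< (suc n) (λ l → ι (n C suc l) * h (suc l) (n ∸ l)))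
      ≈⟨ +-congˡ (+-congˡ drop-last) ⟩
    convolve n (λ i j → h (suc i) j) + convolve n (λ i j → h i (suc j)) ∎
    where
    -- `suc n C 0` and `n C 0` agree definitionally, so this is the initial term of both
    -- `convolve (suc n) h` and the second convolution.
    h₀ = ι (n C 0) * h 0 (suc n)

    pascal : ∀ l → ι (suc n C suc l) * h (suc l) (n ∸ l)
      ≈ ι (n C l) * h (suc l) (n ∸ l) + ι (n C suc l) * h (suc l) (n ∸ l)
    pascal l = begin
      ι (suc n C suc l) * h (suc l) (n ∸ l)
        ≡⟨ cong (λ c → ι c * h (suc l) (n ∸ l)) (nCk+nC[k+1]≡[n+1]C[k+1] n l) ⟨
      ι ((n C l) ℕ.+ (n C suc l)) * h (suc l) (n ∸ l)
        ≈⟨ *-congʳ (ι-+ (n C l) (n C suc l)) ⟩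
      (ι (n C l) + ι (n C suc l)) * h (suc l) (n ∸ l)
        ≈⟨ distribʳ _ _ _ ⟩
      _ ∎

    -- The term `l = n` vanishes with `n C suc n`; for `l < n`, `n ∸ l` is `suc (n ∸ suc l)`.
    drop-last : ∑< (suc n) (λ l → ι (n C suc l) * h (suc l) (n ∸ l))
      ≈ ∑< n (λ l → ι (n C suc l) * h (suc l) (suc (n ∸ suc l)))
    drop-last = begin
      ∑< (suc n) (λ l → ι (n C suc l) * h (suc l) (n ∸ l))
        ≈⟨ ∑<-last n (λ l → ι (n C suc l) * h (suc l) (n ∸ l)) ⟩
      ∑< n (λ l → ι (n C suc l) * h (suc l) (n ∸ l)) + ι (n C suc n) * h (suc n) (n ∸ n)
        ≈⟨ +-congˡ (*-congʳ (×-congˡ (k>n⇒nCk≡0 (ℕ.n<1+n n)))) ⟩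
      ∑< n (λ l → ι (n C suc l) * h (suc l) (n ∸ l)) + 0# * h (suc n) (n ∸ n)
        ≈⟨ trans (+-congˡ (zeroˡ _)) (+-identityʳ _) ⟩
      ∑< n (λ l → ι (n C suc l) * h (suc l) (n ∸ l))
        ≈⟨ ∑<-cong n (λ {l} l<n → *-congˡ (reflexive (cong (h (suc l)) (ℕ.+-∸-assoc 1 l<n)))) ⟩
      ∑< n (λ l → ι (n C suc l) * h (suc l) (suc (n ∸ suc l))) ∎

  -- The recurrence for the generalized Stirling numbers.

  module _ (α β : Carrier) (S : ℕ → ℕ → Carrier) (isStirling : IsGeneralizedStirling α β S) where

    S-degree : ∀ n {k} → n < k → S n k ≈ 0#
    S-degree n = proj₂ isStirling n _

    F : ℕ → ℕ → Carrier
    F k = coeff (falling β k)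

    rising-expansion : ∀ n i → coeff (rising α n) i ≈ ∑< (suc n) (λ k → S n k * F k i)
    rising-expansion n i = begin
      coeff (rising α n) i
        ≈⟨ proj₁ isStirling n i ⟩
      coeff (∑ₚ (map (λ k → S n k ·ₚ falling β k) (upTo (suc n)))) i
        ≡⟨ cong (λ fs → coeff (∑ₚ fs) i) (map-upTo (λ k → S n k ·ₚ falling β k) (suc n)) ⟩
      coeff (∑ₚ (applyUpTo (λ k → S n k ·ₚ falling β k) (suc n))) i
        ≈⟨ coeff-∑ₚ (suc n) (λ k → S n k ·ₚ falling β k) i ⟩
      ∑< (suc n) (λ k → coeff (S n k ·ₚ falling β k) i)
        ≈⟨ ∑<-cong (suc n) (λ {k} _ → coeff-·ₚ (S n k) (falling β k) i) ⟩
      ∑< (suc n) (λ k → S n k * F k i) ∎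

    weight : ℕ → ℕ → Carrier
    weight n k = n ×ᵣ α + k ×ᵣ β

    weight-+ : ∀ m n j k → weight m j + weight n k ≈ weight (m ℕ.+ n) (j ℕ.+ k)
    weight-+ m n j k = begin
      m ×ᵣ α + j ×ᵣ β + (n ×ᵣ α + k ×ᵣ β)
        ≈⟨ solve 4 (λ a b c d → a :+ b :+ (c :+ d) := a :+ c :+ (b :+ d)) refl _ _ _ _ ⟩
      m ×ᵣ α + n ×ᵣ α + (j ×ᵣ β + k ×ᵣ β)
        ≈⟨ +-cong (×-homo-+ α m n) (×-homo-+ β j k) ⟨
      weight (m ℕ.+ n) (j ℕ.+ k) ∎

    -- x + n α = (x - k β) + (n α + k β)
    lin-falling : ∀ n k i → lin (n ×ᵣ α) (F k) i ≈ F (suc k) i + weight n k * F k i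
    lin-falling n k i = begin
      a * F k i + shift (F k) i
        -- Zero is inserted as `(- b + b) * F k i`, after which the semiring solver can treat `- b`
        -- as an independent variable.
        ≈⟨ trans (+-congˡ (zeroˡ _)) (+-identityʳ _) ⟨
      a * F k i + shift (F k) i + 0# * F k i
        ≈⟨ +-congˡ (*-congʳ (-‿inverseˡ b)) ⟨
      a * F k i + shift (F k) i + (- b + b) * F k i
        ≈⟨ solve 5 (λ a b -b x s → a :* x :+ s :+ (-b :+ b) :* x := -b :* x :+ s :+ (a :+ b) :* x)
             refl a b (- b) (F k i) (shift (F k) i) ⟩
      lin (- b) (F k) i + weight n k * F k i
        ≈⟨ +-congʳ (coeff-linearProduct (λ i → - (i ×ᵣ β)) k i) ⟨
      F (suc k) i + weight n k * F k i ∎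
      where
      a = n ×ᵣ α
      b = k ×ᵣ β

    next : ℕ → ℕ → Carrier
    next n k = shift (S n) k + weight n k * S n k

    -- The expansion of `rising α n` is multiplied by its next factor; by `lin-falling` the basis
    -- element `k` then contributes to the elements `suc k` and `k`.
    rising-suc-expansion : ∀ n i →
      coeff (rising α (suc n)) i ≈ ∑< (suc (suc n)) (λ k → next n k * F k i)
    rising-suc-expansion n i = begin
      coeff (rising α (suc n)) i
        ≈⟨ coeff-linearProduct (_×ᵣ α) n i ⟩
      lin (n ×ᵣ α) (coeff (rising α n)) i
        ≈⟨ lin-cong (rising-expansion n) i ⟩
      lin (n ×ᵣ α) (λ j → ∑< (suc n) (λ k → S n k * F k j)) i
        ≈⟨ lin-∑< (n ×ᵣ α) (suc n) (S n) F i ⟩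
      ∑< (suc n) (λ k → S n k * lin (n ×ᵣ α) (F k) i)
        ≈⟨ ∑<-cong (suc n) (λ {k} _ → trans (*-congˡ (lin-falling n k i)) (split k)) ⟩
      ∑< (suc n) (λ k → S n k * F (suc k) i + weight n k * S n k * F k i)
        ≈⟨ ∑<-+ (suc n) (λ k → S n k * F (suc k) i) (λ k → weight n k * S n k * F k i) ⟩
      ∑< (suc n) (λ k → S n k * F (suc k) i) + ∑< (suc n) (λ k → weight n k * S n k * F k i)
        -- Both sums are extended to the full range: the first by a zero term in front, from
        -- `shift`, the second by a last term containing `S n (suc n)`, which is 0.
        ≈⟨ +-cong first second ⟩
      ∑< (suc (suc n)) (λ k → shift (S n) k * F k i)
        + ∑< (suc (suc n)) (λ k → weight n k * S n k * F k i)
        ≈⟨ ∑<-+ (suc (suc n)) (λ k → shift (S n) k * F k i) (λ k → weight n k * S n k * F k i) ⟨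
      ∑< (suc (suc n)) (λ k → shift (S n) k * F k i + weight n k * S n k * F k i)
        ≈⟨ ∑<-cong (suc (suc n)) {λ k → next n k * F k i} (λ _ → distribʳ _ _ _) ⟨
      ∑< (suc (suc n)) (λ k → next n k * F k i) ∎
      where
      split : ∀ k → S n k * (F (suc k) i + weight n k * F k i)
        ≈ S n k * F (suc k) i + weight n k * S n k * F k i
      split k = solve 4 (λ s f w g → s :* (f :+ w :* g) := s :* f :+ w :* s :* g) refl _ _ _ _

      first : ∑< (suc n) (λ k → S n k * F (suc k) i)
        ≈ ∑< (suc (suc n)) (λ k → shift (S n) k * F k i)
      first = sym (trans (+-congʳ (zeroˡ _)) (+-identityˡ _))

      second : ∑< (suc n) (λ k → weight n k * S n k * F k i)
        ≈ ∑< (suc (suc n)) (λ k → weight n k * S n k * F k i)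
      second = sym (begin
        ∑< (suc (suc n)) (λ k → weight n k * S n k * F k i)
          ≈⟨ ∑<-last (suc n) (λ k → weight n k * S n k * F k i) ⟩
        _ + weight n (suc n) * S n (suc n) * F (suc n) i
          ≈⟨ +-congˡ (*-congʳ (trans (*-congˡ (S-degree n ℕ.≤-refl)) (zeroʳ _))) ⟩
        _ + 0# * F (suc n) i
          ≈⟨ trans (+-congˡ (zeroˡ _)) (+-identityʳ _) ⟩
        _ ∎)

    -- For `k` at most `suc n`, both sides are the coordinate `k` of `rising α (suc n)` in the
    -- falling basis. For larger `k`, all the values of `S` involved vanish.
    S-suc : ∀ n k → S (suc n) k ≈ shift (S n) k + weight n k * S n k
    S-suc n k with k ℕ.<? suc (suc n)
    ... | yes k<2+n = expansion-unique F
      (linearProduct-monic (λ i → - (i ×ᵣ β))) (linearProduct-degree (λ i → - (i ×ᵣ β)))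
      (suc (suc n)) (S (suc n)) (next n)
      (λ i → trans (sym (rising-expansion (suc n) i)) (rising-suc-expansion n i)) k<2+n
    ... | no k≮2+n = above k (ℕ.≮⇒≥ k≮2+n)
      where
      above : ∀ k → suc n < k → S (suc n) k ≈ shift (S n) k + weight n k * S n k
      above (suc k) 1+n<1+k@(s≤s n<k) = begin
        S (suc n) (suc k)                     ≈⟨ S-degree (suc n) 1+n<1+k ⟩
        0#                                    ≈⟨ trans (+-identityˡ _) (zeroʳ _) ⟨
        0# + weight n (suc k) * 0#            ≈⟨ +-cong (S-degree n n<k) (*-congˡ (S-degree n (ℕ.m<n⇒m<1+n n<k))) ⟨
        S n k + weight n (suc k) * S n (suc k) ∎

    S-zero-zero : S 0 0 ≈ 1#
    S-zero-zero = sym (trans (rising-expansion 0 0) (trans (+-identityʳ _) (*-identityʳ _)))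

    -- At `k = 0` the recurrence is multiplication by `weight n 0`, and `weight 0 0` is 0, which
    -- kills the initial value `S 0 0`.
    S-suc-zero : ∀ n → S (suc n) 0 ≈ 0#
    S-suc-zero n = trans (S-suc n 0) (trans (+-identityˡ _) (vanish n))
      where
      vanish : ∀ n → weight n 0 * S n 0 ≈ 0#
      vanish zero    = trans (*-congʳ (+-identityˡ 0#)) (zeroˡ _)
      vanish (suc n) = trans (*-congˡ (S-suc-zero n)) (zeroʳ _)

    -- The identity for two parts.

    -- Induction on `n` for all `a` and `b` at once, since the recurrence lowers the second index of
    -- `S`. The case `suc n` uses `S-binomial-shift` at `n`, which in turn uses `S-binomial` at `n`.
    S-binomial : ∀ n a b → ι ((a ℕ.+ b) C a) * S n (a ℕ.+ b) ≈ convolve n (λ i j → S i a * S j b)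

    -- If `a` and `b` are positive, Pascal's rule splits the left-hand side into two instances of
    -- `S-binomial`, one with `a` lowered and one with `b` lowered. If one of them is 0, the
    -- convolution that would lower it vanishes.
    S-binomial-shift : ∀ n a b → ι ((a ℕ.+ b) C a) * shift (S n) (a ℕ.+ b)
      ≈ convolve n (λ i j → shift (S i) a * S j b) + convolve n (λ i j → S i a * shift (S j) b)
    S-binomial-shift n zero zero = trans (zeroʳ _) (sym (trans
      (+-cong (convolve-zero n (λ i j → 0# * S j 0) (λ _ _ → zeroˡ _))
        (convolve-zero n (λ i j → S i 0 * 0#) (λ _ _ → zeroʳ _)))
      (+-identityˡ 0#)))
    S-binomial-shift n zero (suc b) = trans (S-binomial n 0 b) (sym (trans
      (+-congʳ (convolve-zero n (λ i j → 0# * S j (suc b)) (λ _ _ → zeroˡ _))) (+-identityˡ _)))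
    S-binomial-shift n (suc a) zero = begin
      ι (suc (a ℕ.+ 0) C suc a) * S n (a ℕ.+ 0)
        ≡⟨ cong (λ c → ι c * S n (a ℕ.+ 0))
             (≡.trans (cong (λ m → suc m C suc a) (ℕ.+-identityʳ a)) (≡.trans (nCn≡1 (suc a))
             (≡.sym (≡.trans (cong (_C a) (ℕ.+-identityʳ a)) (nCn≡1 a))))) ⟩
      ι ((a ℕ.+ 0) C a) * S n (a ℕ.+ 0)
        ≈⟨ S-binomial n a 0 ⟩
      convolve n (λ i j → S i a * S j 0)
        ≈⟨ trans (+-congˡ (convolve-zero n (λ i j → S i (suc a) * 0#) (λ _ _ → zeroʳ _))) (+-identityʳ _) ⟨
      _ ∎
    S-binomial-shift n (suc a) (suc b) = begin
      ι (suc (a ℕ.+ suc b) C suc a) * S n (a ℕ.+ suc b)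
        ≡⟨ cong (λ c → ι c * S n (a ℕ.+ suc b)) (nCk+nC[k+1]≡[n+1]C[k+1] (a ℕ.+ suc b) a) ⟨
      ι (((a ℕ.+ suc b) C a) ℕ.+ ((a ℕ.+ suc b) C suc a)) * S n (a ℕ.+ suc b)
        ≈⟨ trans (*-congʳ (ι-+ ((a ℕ.+ suc b) C a) _)) (distribʳ _ _ _) ⟩
      ι ((a ℕ.+ suc b) C a) * S n (a ℕ.+ suc b) + ι ((a ℕ.+ suc b) C suc a) * S n (a ℕ.+ suc b)
        -- Only the second summand is rewritten, from `a + suc b` to `suc a + b`, the form of
        -- `S-binomial n (suc a) b`.
        ≡⟨ cong (λ m → ι ((a ℕ.+ suc b) C a) * S n (a ℕ.+ suc b) + ι (m C suc a) * S n m) (ℕ.+-suc a b) ⟩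
      ι ((a ℕ.+ suc b) C a) * S n (a ℕ.+ suc b) + ι ((suc a ℕ.+ b) C suc a) * S n (suc a ℕ.+ b)
        ≈⟨ +-cong (S-binomial n a (suc b)) (S-binomial n (suc a) b) ⟩
      _ ∎

    -- For `n = 0` the convolution is a single term. Both sides vanish unless `a` and `b` are 0,
    -- where `S 0 0` has to equal its own square.
    S-binomial zero zero zero = begin
      ι 1 * S 0 0                 ≈⟨ *-congˡ (*-identityʳ _) ⟨
      ι 1 * (S 0 0 * 1#)          ≈⟨ *-congˡ (*-congˡ S-zero-zero) ⟨
      ι 1 * (S 0 0 * S 0 0)       ≈⟨ +-identityʳ _ ⟨
      ι 1 * (S 0 0 * S 0 0) + 0#  ∎
    S-binomial zero zero (suc b) = trans (trans (*-congˡ (S-degree 0 z<s)) (zeroʳ _)) (sym (trans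
      (+-identityʳ _) (trans (*-congˡ (trans (*-congˡ (S-degree 0 z<s)) (zeroʳ _))) (zeroʳ _))))
    S-binomial zero (suc a) b = trans (trans (*-congˡ (S-degree 0 z<s)) (zeroʳ _)) (sym (trans
      (+-identityʳ _) (trans (*-congˡ (trans (*-congʳ (S-degree 0 z<s)) (zeroˡ _))) (zeroʳ _))))
    S-binomial (suc n) a b = begin
      ι c′ * S (suc n) (a ℕ.+ b)
        ≈⟨ *-congˡ (S-suc n (a ℕ.+ b)) ⟩
      ι c′ * (shift (S n) (a ℕ.+ b) + w * S n (a ℕ.+ b))
        ≈⟨ solve 4 (λ c s w x → c :* (s :+ w :* x) := c :* s :+ w :* (c :* x)) refl _ _ _ _ ⟩
      ι c′ * shift (S n) (a ℕ.+ b) + w * (ι c′ * S n (a ℕ.+ b))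
        ≈⟨ +-cong (S-binomial-shift n a b) (*-congˡ (S-binomial n a b)) ⟩
      convolve n U + convolve n V + w * convolve n T
        ≈⟨ +-cong (convolve-+ n U V) (convolve-*ˡ n w T) ⟨
      convolve n (λ i j → U i j + V i j) + convolve n (λ i j → w * T i j)
        ≈⟨ convolve-+ n (λ i j → U i j + V i j) (λ i j → w * T i j) ⟨
      convolve n (λ i j → U i j + V i j + w * T i j)
        ≈⟨ convolve-cong n (λ i j → U i j + V i j + w * T i j)
             (λ i j → S (suc i) a * S j b + S i a * S (suc j) b) termwise ⟩
      convolve n (λ i j → S (suc i) a * S j b + S i a * S (suc j) b)
        ≈⟨ convolve-+ n (λ i j → S (suc i) a * S j b) (λ i j → S i a * S (suc j) b) ⟩
      convolve n (λ i j → S (suc i) a * S j b) + convolve n (λ i j → S i a * S (suc j) b)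
        ≈⟨ convolve-suc n (λ i j → S i a * S j b) ⟨
      convolve (suc n) (λ i j → S i a * S j b) ∎
      where
      c′ = (a ℕ.+ b) C a
      w = weight n (a ℕ.+ b)

      T U V : ℕ → ℕ → Carrier
      T i j = S i a * S j b
      U i j = shift (S i) a * S j b
      V i j = S i a * shift (S j) b

      termwise : ∀ i j → i ℕ.+ j ≡ n →
        U i j + V i j + w * T i j ≈ S (suc i) a * S j b + S i a * S (suc j) b
      -- With `n` identified with `i + j`, the weight `w` splits into `weight i a + weight j b`, so
      -- each factor receives its own recurrence.
      termwise i j ≡.refl = begin
        U i j + V i j + w * T i j
          ≈⟨ +-congˡ (*-congʳ (weight-+ i j a b)) ⟨
        U i j + V i j + (weight i a + weight j b) * T i j
          ≈⟨ solve 6 (λ s t x y v w → s :* y :+ x :* t :+ (v :+ w) :* (x :* y)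
               := (s :+ v :* x) :* y :+ x :* (t :+ w :* y)) refl _ _ _ _ _ _ ⟩
        (shift (S i) a + weight i a * S i a) * S j b + S i a * (shift (S j) b + weight j b * S j b)
          ≈⟨ +-cong (*-congʳ (S-suc i a)) (*-congˡ (S-suc j b)) ⟨
        S (suc i) a * S j b + S i a * S (suc j) b ∎

    -- The identity for any number of parts.

    -- Induction on `ks`. The empty vector reduces to the values `S n 0`. For `k ∷ ks`, `S-binomial`
    -- with lower indices `k` and `sum ks` separates the first part, and the induction hypothesis
    -- expands `S (n ∸ l) (sum ks)` for each `l`.
    S-multinomial : ∀ {p} n (ks : Vec ℕ p) → ι (multinomial (sum ks) ks) * S n (sum ks)
      ≈ ∑ (map (λ ls → multinomial n ls ×ᵣ ∏ (zipWith S ls ks)) (weakCompositions p n))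
    S-multinomial zero    []   = trans (*-congˡ S-zero-zero) (trans (*-identityʳ _) (sym (+-identityʳ _)))
    S-multinomial (suc n) []   = trans (*-congˡ (S-suc-zero n)) (zeroʳ _)
    S-multinomial {suc p} n (k ∷ ks) = begin
      ι (multinomial (sum (k ∷ ks)) (k ∷ ks)) * S n (k ℕ.+ sum ks)
        ≡⟨ cong (λ c → ι c * S n (k ℕ.+ sum ks)) (multinomial-∷ k ks) ⟩
      ι (((k ℕ.+ sum ks) C k) ℕ.* m) * S n (k ℕ.+ sum ks)
        ≈⟨ *-congʳ (×1-homo-* ((k ℕ.+ sum ks) C k) m) ⟩
      ι ((k ℕ.+ sum ks) C k) * ι m * S n (k ℕ.+ sum ks)
        ≈⟨ solve 3 (λ c m s → c :* m :* s := m :* (c :* s)) refl _ _ _ ⟩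
      ι m * (ι ((k ℕ.+ sum ks) C k) * S n (k ℕ.+ sum ks))
        ≈⟨ *-congˡ (S-binomial n k (sum ks)) ⟩
      ι m * convolve n (λ i j → S i k * S j (sum ks))
        ≈⟨ convolve-*ˡ n (ι m) (λ i j → S i k * S j (sum ks)) ⟨
      convolve n (λ i j → ι m * (S i k * S j (sum ks)))
        ≡⟨ cong ∑ (map-upTo _ (suc n)) ⟨
      ∑ (map (λ l → ι (n C l) * (ι m * (S l k * S (n ∸ l) (sum ks)))) (upTo (suc n)))
        ≈⟨ ∑-cong (All.map (λ {l} l<1+n → fibre l (ℕ.≤-pred l<1+n)) (All.all-upTo (suc n))) ⟩
      ∑ (map (λ l → ∑ (map term (map (l ∷_) (weakCompositions p (n ∸ l))))) (upTo (suc n)))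
        ≈⟨ ∑-concatMap term (λ l → map (l ∷_) (weakCompositions p (n ∸ l))) (upTo (suc n)) ⟨
      ∑ (map term (weakCompositions (suc p) n)) ∎
      where
      m = multinomial (sum ks) ks

      term : Vec ℕ (suc p) → Carrier
      term ls = multinomial n ls ×ᵣ ∏ (zipWith S ls (k ∷ ks))

      tailTerm : ℕ → Vec ℕ p → Carrier
      tailTerm l ls = multinomial (n ∸ l) ls ×ᵣ ∏ (zipWith S ls ks)

      -- The totals are variables here so that both equations can be matched with `≡.refl`; `j` is
      -- later `n ∸ l`.
      multinomial-∷-∸ : ∀ {n j} l (ls : Vec ℕ p) → l ℕ.+ j ≡ n → sum ls ≡ j →
        multinomial n (l ∷ ls) ≡ (n C l) ℕ.* multinomial j ls
      multinomial-∷-∸ l ls ≡.refl ≡.refl = multinomial-∷ l ls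

      term-∷ : ∀ l ls → l ≤ n → sum ls ≡ n ∸ l →
        ι (n C l) * S l k * tailTerm l ls ≈ term (l ∷ ls)
      term-∷ l ls l≤n eq = begin
        ι (n C l) * S l k * tailTerm l ls
          ≈⟨ *-congˡ (×≈ι* (multinomial (n ∸ l) ls) _) ⟩
        ι (n C l) * S l k * (ι (multinomial (n ∸ l) ls) * ∏ (zipWith S ls ks))
          ≈⟨ solve 4 (λ c s m x → c :* s :* (m :* x) := c :* m :* (s :* x)) refl _ _ _ _ ⟩
        ι (n C l) * ι (multinomial (n ∸ l) ls) * ∏ (zipWith S (l ∷ ls) (k ∷ ks))
          ≈⟨ *-congʳ (×1-homo-* (n C l) (multinomial (n ∸ l) ls)) ⟨
        ι ((n C l) ℕ.* multinomial (n ∸ l) ls) * ∏ (zipWith S (l ∷ ls) (k ∷ ks))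
          ≈⟨ ×≈ι* ((n C l) ℕ.* multinomial (n ∸ l) ls) _ ⟨
        ((n C l) ℕ.* multinomial (n ∸ l) ls) ×ᵣ ∏ (zipWith S (l ∷ ls) (k ∷ ks))
          ≡⟨ cong (_×ᵣ ∏ (zipWith S (l ∷ ls) (k ∷ ks))) (multinomial-∷-∸ l ls (ℕ.m+[n∸m]≡n l≤n) eq) ⟨
        term (l ∷ ls) ∎

      -- The right-hand side collects the compositions of `n` with first part `l`.
      fibre : ∀ l → l ≤ n → ι (n C l) * (ι m * (S l k * S (n ∸ l) (sum ks)))
        ≈ ∑ (map term (map (l ∷_) (weakCompositions p (n ∸ l))))
      fibre l l≤n = begin
        ι (n C l) * (ι m * (S l k * S (n ∸ l) (sum ks)))
          ≈⟨ solve 4 (λ c m s t → c :* (m :* (s :* t)) := c :* s :* (m :* t)) refl _ _ _ _ ⟩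
        ι (n C l) * S l k * (ι m * S (n ∸ l) (sum ks))
          ≈⟨ *-congˡ (S-multinomial (n ∸ l) ks) ⟩
        ι (n C l) * S l k * ∑ (map (tailTerm l) (weakCompositions p (n ∸ l)))
          ≈⟨ ∑-*ˡ (ι (n C l) * S l k) (tailTerm l) (weakCompositions p (n ∸ l)) ⟨
        ∑ (map (λ ls → ι (n C l) * S l k * tailTerm l ls) (weakCompositions p (n ∸ l)))
          ≈⟨ ∑-cong (All.map (λ {ls} → term-∷ l ls l≤n) (weakCompositions-sum p (n ∸ l))) ⟩
        ∑ (map (λ ls → term (l ∷ ls)) (weakCompositions p (n ∸ l)))
          ≡⟨ cong ∑ (map-∘ (weakCompositions p (n ∸ l))) ⟩
        ∑ (map term (map (l ∷_) (weakCompositions p (n ∸ l)))) ∎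

theorem7 : ∀ {c ℓ} (R : CommutativeRing c ℓ) →
  let open CommutativeRing R
      open GeneralizedStirling R
  in
  (α β : Carrier) (S : ℕ → ℕ → Carrier) → IsGeneralizedStirling α β S →
  (n p : ℕ) → 1 ≤ p →
  (k : ℕ) (ks : Vec ℕ p) → k ≡ sum ks →
  multinomial k ks ×ᵣ S n k
    ≈ ∑ (map (λ ls → multinomial n ls ×ᵣ ∏ (zipWith S ls ks)) (weakCompositions p n))
theorem7 R α β S isStirling n p _ _ ks ≡.refl = trans
  (×≈ι* R (multinomial (sum ks) ks) (S n (sum ks)))
  (S-multinomial R α β S isStirling n ks)
  where open CommutativeRing R using (trans)
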